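{- Let $\kappa\leq\lambda$ be infinite cardinals with $\kappa$ regular, let $X\subseteq{}^{\kappa}\lambda$ be a subspace of weight at most $\lambda$, and let $\mathbb{S}$ be a positively totally ordered monoid equipped with the infinitary sum $\sum$. Let $(X,\mathfrak{M},\mu)$ be a continuous weak $\lambda^+$-measure space, with $\mu$ taking values in $(\mathbb{S},\sum)$, such that $\mathfrak{M}$ is closed under finite intersections. Then there is a clopen partition $\mathcal{P}$ of $X$ such that $(P,\mathfrak{M}\downarrow P,\mu\downarrow P)$ is an $\omega_1$-Dirac, continuous, weak $\lambda^+$-measure space for every $P\in\mathcal{P}$, and $\mu$ is the sum of $(\mu\downarrow P)_{P\in\mathcal{P}}$, i.e., for every $M\in\mathfrak{M}$ we have \[\mu(M)=\sum_{P\in\mathcal{P}}(\mu\downarrow P)(M\cap P).\]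
   Context: **Topology.** ${}^{\kappa}\lambda$ is the set of sequences of elements of $\lambda$ of length $\kappa$, with the bounded topology, generated by the cones $\mathbf{N}_s=\{x\in{}^{\kappa}\lambda\mid s\subseteq x\}$ for $s\in{}^{<\kappa}\lambda=\bigcup_{\alpha<\kappa}{}^{\alpha}\lambda$. Subsets carry the subspace topology. **Monoids and sums.** A positively totally ordered monoid is $\mathbb{S}=(S,0,+,\leq)$ where $+$ is associative (not necessarily commutative) with neutral element $0$, $\leq$ is a total order, $a\leq b$ and $c\leq d$ imply $a+c\leq b+d$, $0$ is the minimum of $\leq$, and $S\neq\{0\}$. The infinitary sum $\sum$ on $\mathbb{S}$ is the partial function on sequences of elements of $S$ of arbitrary ordinal length given by $\sum(s)=\sup\{s_{\alpha_0}+\dots+s_{\alpha_k}\mid\alpha_0<\dots<\alpha_k<\gamma\}$ for $s=\langle s_\alpha\mid\alpha<\gamma\rangle$, defined exactly when this supremum exists in $\mathbb{S}$. A sum $\sum_{P\in\mathcal{P}}$ over a set of size $\leq\lambda$ is computed along an enumeration of $\mathcal{P}$ of length $<\lambda^+$. **Measures.** A weakly $\lambda^+$-measurable space is a pair $(X,\mathfrak{M})$ where $X$ is a topological space and $\mathfrak{M}$ is a family of subsets of $X$ closed under unions of size $\leq\lambda$ and containing all open subsets of $X$. A $\lambda^+$-measure on it (with values in $(\mathbb{S},\sum)$) is a partial function $\mu:\mathscr{P}(X)\to\mathbb{S}$ with $\mathfrak{M}\subseteq\mathrm{dom}(\mu)$ such that: (M1) $\mu(\emptyset)=0$; (M2)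 $\mu(X)>0$; (M3) $A\subseteq B$ implies $\mu(A)\leq\mu(B)$ for all $A,B\in\mathfrak{M}$; (M4) for every family $(A_i)_{i<\gamma}$ of pairwise disjoint sets of $\mathfrak{M}$ of length an ordinal $\gamma<\lambda^+$, we have $\langle\mu(A_i)\mid i<\gamma\rangle\in\mathrm{dom}(\sum)$ and $\mu(\bigcup_{i<\gamma}A_i)=\sum_{i<\gamma}\mu(A_i)$; (M5) for every $x\in X$ with $\{x\}\in\mathfrak{M}$ and every open local basis $\{A_i\mid i<\gamma\}$ at $x$ with $\gamma<\lambda^+$, $\mu(\{x\})=\inf_{i<\gamma}\mu(A_i)$. Then $(X,\mathfrak{M},\mu)$ is called a weak $\lambda^+$-measure space. It is continuous if $\{x\}\in\mathfrak{M}$ and $\mu(\{x\})=0$ for every $x\in X$. The support of $\mu$ is $\mathrm{supp}(\mu)=X\setminus\bigcup\{O\mid O\text{ open},\ \mu(O)=0\}$. For a cardinal $\gamma$, $\mu$ is $\gamma$-Dirac if $\mathrm{supp}(\mu)$ has weight strictly less than $\gamma$. **Restriction.** For $Y\subseteq X$, $\mathfrak{M}\downarrow Y=\{M\cap Y\mid M\in\mathfrak{M}\}$, and $\mu\downarrow Y$ is the partial function given by $(\mu\downarrow Y)(A)=\inf\{\mu(M)\mid M\in\mathfrak{M},\ M\cap Y=A\}$ for all $A\in\mathfrak{M}\downarrow Y$ for which this infimum exists. -}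

module Defs where

open import Level using (_⊔_; suc; 0ℓ)
open import Algebra.Core using (Op₂)
open import Algebra.Structures using (IsMonoid)
open import Data.List.Base using (_∷_)
open import Data.List.NonEmpty as List⁺ using (foldr₁; _∷_)
open import Data.List.Relation.Unary.Linked using (Linked)
open import Data.Nat.Base as ℕ using (ℕ)
open import Data.Nat.Induction using (<-wellFounded)
open import Data.Nat.Properties using (<-isStrictTotalOrder)
open import Data.Product using (Σ-syntax; ∃-syntax; _×_; _,_)
open import Function.Bundles using (_↣_; Injection)
open import Induction.WellFounded using (WellFounded)
open import Relation.Binary.Core using (Rel)
open import Relation.Binary.Definitions using (Minimum)
open import Relation.Binary.PropositionalEquality using (_≡_; _≢_)
open import Relation.Binary.Structures using (IsStrictTotalOrder; IsTotalOrder)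
open import Relation.Nullary using (¬_)
open import Relation.Unary using (Pred; _∈_; _⊆_; _≐_; _∩_; _∖_; ⋃; _≬_; _⊥_; ｛_｝; Satisfiable)
open import Relation.Unary.Polymorphic using (∅; U)

-- Sets are types in Set ℓ, and a subset is a predicate, taken up to _≐_.  Hence
-- the resp fields below: families and partial functions on subsets respect _≐_.

-- An ordinal is given by a well-ordered type; the elements of its carrier
-- play the role of the smaller ordinals.
record Ordinal ℓ : Set (suc ℓ) where
  infix 4 _<_
  field
    Carrier            : Set ℓ
    _<_                : Rel Carrier ℓ
    isStrictTotalOrder : IsStrictTotalOrder _≡_ _<_
    wellFounded        : WellFounded _<_

open Ordinal using (Carrier)

ω : Ordinal 0ℓ
ω = record
  { Carrier            = ℕ
  ; _<_                = ℕ._<_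
  ; isStrictTotalOrder = <-isStrictTotalOrder
  ; wellFounded        = <-wellFounded
  }

-- The functions from α to A, for an element α of κ.  The irrelevant argument
-- makes the value independent of the proof of β < α.
Below : ∀ {ℓ a} (κ : Ordinal ℓ) → Carrier κ → Set a → Set (ℓ ⊔ a)
Below κ α A = ∀ β → .(β < α) → A
  where open Ordinal κ using (_<_)

-- α injects into none of its proper initial segments.
IsCardinal : ∀ {ℓ} → Ordinal ℓ → Set ℓ
IsCardinal α = ∀ i → ¬ (Σ[ f ∈ (Carrier α ↣ Carrier α) ] (∀ j → Injection.to f j < i))
  where open Ordinal α using (_<_)

IsInfiniteCardinal : ∀ {ℓ} → Ordinal ℓ → Set ℓ
IsInfiniteCardinal α = IsCardinal α × (ℕ ↣ Carrier α)

-- Every function from some α < κ to κ is bounded, i.e. cof(κ) = κ.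
IsRegular : ∀ {ℓ} → Ordinal ℓ → Set ℓ
IsRegular κ = ∀ α (f : Below κ α (Carrier κ)) → ∃[ b ] (∀ ξ (ξ<α : ξ < α) → f ξ ξ<α < b)
  where open Ordinal κ using (_<_)

-- The successor cardinal λ⁺, presented as the class of the ordinals below it:
-- those of cardinality at most λ.  In particular ω ⁺ is ω₁.
infix 8 _⁺
_⁺ : ∀ {a ℓ} → Ordinal a → Pred (Ordinal ℓ) (a ⊔ ℓ)
(c ⁺) δ = Carrier δ ↣ Carrier c

record Topology {ℓ} (Ω : Set ℓ) : Set (suc (suc ℓ)) where
  field
    Open   : Pred (Pred Ω ℓ) (suc ℓ)
    whole  : Open U
    inter  : ∀ {V W} → Open V → Open W → Open (V ∩ W)
    union  : ∀ {I : Set ℓ} (V : I → Pred Ω ℓ) → (∀ i → Open (V i)) → Open (⋃ I V)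
    resp-≐ : ∀ {V W} → V ≐ W → Open V → Open W

data Generated {ℓ} {Ω I : Set ℓ} (B : I → Pred Ω ℓ) : Pred (Pred Ω ℓ) (suc ℓ) where
  gen-basic  : ∀ i → Generated B (B i)
  gen-whole  : Generated B U
  gen-inter  : ∀ {V W} → Generated B V → Generated B W → Generated B (V ∩ W)
  gen-union  : ∀ {J : Set ℓ} (V : J → Pred Ω ℓ) → (∀ j → Generated B (V j)) → Generated B (⋃ J V)
  gen-resp-≐ : ∀ {V W} → V ≐ W → Generated B V → Generated B W

generatedBy : ∀ {ℓ} {Ω I : Set ℓ} → (I → Pred Ω ℓ) → Topology Ω
generatedBy B = record
  { Open   = Generated B
  ; whole  = gen-whole
  ; inter  = gen-inter
  ; union  = gen-union
  ; resp-≐ = gen-resp-≐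
  }

module _ {ℓ} (κ Λ : Ordinal ℓ) where
  open Ordinal κ using (_<_)

  Seq : Set ℓ
  Seq = Carrier κ → Carrier Λ

  Seq< : Set ℓ
  Seq< = Σ[ α ∈ Carrier κ ] Below κ α (Carrier Λ)

  cone : Seq< → Pred Seq ℓ
  cone (α , s) x = ∀ β (β<α : β < α) → x β ≡ s β β<α

  boundedTopology : Topology Seq
  boundedTopology = generatedBy cone

-- A topological space is a subset X of the points Ω of an ambient topology,
-- carrying the subspace topology.  If P ⊆ X, the topology that P inherits
-- from X is the one it inherits from Ω.
module _ {ℓ} {Ω : Set ℓ} (T : Topology Ω) where
  open Topology T using (Open)

  OpenIn : ∀ {c u} → Pred Ω c → Pred Ω u → Set (suc ℓ ⊔ c ⊔ u)
  OpenIn X A = Σ[ V ∈ Pred Ω ℓ ] Open V × A ≐ (V ∩ X)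

  ClopenIn : ∀ {c u} → Pred Ω c → Pred Ω u → Set (suc ℓ ⊔ c ⊔ u)
  ClopenIn X A = OpenIn X A × OpenIn X (X ∖ A)

  record IsBase {c i} (X : Pred Ω c) {I : Set i} (B : I → Pred Ω (ℓ ⊔ c))
         : Set (suc (ℓ ⊔ c) ⊔ i) where
    field
      open-B  : ∀ i → OpenIn X (B i)
      refines : ∀ (A : Pred Ω (ℓ ⊔ c)) → OpenIn X A →
                ∀ {x} → x ∈ A → ∃[ i ] x ∈ B i × B i ⊆ A

  record IsLocalBasis (X : Pred Ω ℓ) (x : Ω) {I : Set ℓ} (B : I → Pred Ω ℓ)
         : Set (suc ℓ) where
    field
      open-B  : ∀ i → OpenIn X (B i)
      x∈B     : ∀ i → x ∈ B i
      refines : ∀ (A : Pred Ω ℓ) → OpenIn X A → x ∈ A → ∃[ i ] B i ⊆ A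

  -- The weight of X is smaller than the cardinal whose smaller ordinals form
  -- the class Γ.  (A base may be enumerated with repetitions.)
  WeightBelow : ∀ {c g} → Pred Ω c → Pred (Ordinal ℓ) g → Set (suc (ℓ ⊔ c) ⊔ g)
  WeightBelow {c} X Γ =
    Σ[ δ ∈ Ordinal ℓ ] δ ∈ Γ × (Σ[ B ∈ (Carrier δ → Pred Ω (ℓ ⊔ c)) ] IsBase X B)

  WeightAtMost : ∀ {c} → Pred Ω c → Ordinal ℓ → Set (suc (ℓ ⊔ c))
  WeightAtMost X c = WeightBelow X (c ⁺)

  record IsClopenPartition (X : Pred Ω ℓ) (𝒫 : Pred (Pred Ω ℓ) (suc ℓ))
         : Set (suc ℓ) where
    field
      resp-≐   : ∀ {P Q} → P ≐ Q → P ∈ 𝒫 → Q ∈ 𝒫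
      clopen   : ∀ {P} → P ∈ 𝒫 → ClopenIn X P
      nonempty : ∀ {P} → P ∈ 𝒫 → Satisfiable P
      disjoint : ∀ {P Q} → P ∈ 𝒫 → Q ∈ 𝒫 → P ≬ Q → P ≐ Q
      covers   : ∀ {x} → x ∈ X → ∃[ P ] P ∈ 𝒫 × x ∈ P

record IsEnumeration {ℓ} {Ω : Set ℓ} (𝒫 : Pred (Pred Ω ℓ) (suc ℓ))
       (γ : Ordinal ℓ) (e : Carrier γ → Pred Ω ℓ) : Set (suc ℓ) where
  field
    member     : ∀ i → e i ∈ 𝒫
    injective  : ∀ {i j} → e i ≐ e j → i ≡ j
    surjective : ∀ {P} → P ∈ 𝒫 → ∃[ i ] e i ≐ P

record PositiveTotallyOrderedMonoid ℓ : Set (suc ℓ) where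
  infix  4 _≈_ _≤_
  infixl 6 _+_
  field
    S            : Set ℓ
    _≈_          : Rel S ℓ
    _≤_          : Rel S ℓ
    _+_          : Op₂ S
    0#           : S
    isMonoid     : IsMonoid _≈_ _+_ 0#
    isTotalOrder : IsTotalOrder _≈_ _≤_
    +-mono-≤     : ∀ {a b c d} → a ≤ b → c ≤ d → a + c ≤ b + d
    0-minimum    : Minimum _≤_ 0#
    nontrivial   : ∃[ a ] ¬ a ≈ 0#

  IsSup : ∀ {p} → Pred S p → S → Set (ℓ ⊔ p)
  IsSup P v = (∀ {a} → a ∈ P → a ≤ v) × (∀ u → (∀ {a} → a ∈ P → a ≤ u) → v ≤ u)

  IsInf : ∀ {p} → Pred S p → S → Set (ℓ ⊔ p)
  IsInf P v = (∀ {a} → a ∈ P → v ≤ a) × (∀ u → (∀ {a} → a ∈ P → u ≤ a) → u ≤ v)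

  -- The finite sums s_{α₀} + … + s_{αₖ} with α₀ < … < αₖ < γ.
  FiniteSums : (γ : Ordinal ℓ) → (Carrier γ → S) → Pred S ℓ
  FiniteSums γ s a =
    ∃[ α ] ∃[ αs ] Linked _<_ (α ∷ αs) × a ≈ foldr₁ _+_ (List⁺.map s (α ∷ αs))
    where open Ordinal γ using (_<_)

  -- ∑ s is defined and equal to v.
  IsSum : (γ : Ordinal ℓ) → (Carrier γ → S) → S → Set ℓ
  IsSum γ s v = IsSup (FiniteSums γ s) v

module Measure {ℓ} {Ω : Set ℓ} (T : Topology Ω) (Λ : Ordinal ℓ)
               (𝕊 : PositiveTotallyOrderedMonoid ℓ) where
  open PositiveTotallyOrderedMonoid 𝕊

  Family : Set (suc (suc ℓ))
  Family = Pred (Pred Ω ℓ) (suc ℓ)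

  -- A partial function from subsets of Ω to S is given by its graph: μ A v
  -- says that μ(A) is defined and equal to v.
  Graph : Set (suc (suc ℓ))
  Graph = Pred Ω ℓ → Pred S (suc ℓ)

  record IsPartialFunction (X : Pred Ω ℓ) (μ : Graph) : Set (suc ℓ) where
    field
      dom⊆       : ∀ {A v} → μ A v → A ⊆ X
      resp       : ∀ {A B u v} → A ≐ B → u ≈ v → μ A u → μ B v
      functional : ∀ {A u v} → μ A u → μ A v → u ≈ v

  record IsWeaklyMeasurable (X : Pred Ω ℓ) (𝔐 : Family) : Set (suc ℓ) where
    field
      𝔐⊆     : ∀ {A} → A ∈ 𝔐 → A ⊆ X
      resp-≐ : ∀ {A B} → A ≐ B → A ∈ 𝔐 → B ∈ 𝔐
      union  : ∀ {I : Set ℓ} → I ↣ Carrier Λ →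
               (A : I → Pred Ω ℓ) → (∀ i → A i ∈ 𝔐) → ⋃ I A ∈ 𝔐
      opens  : ∀ {A : Pred Ω ℓ} → OpenIn T X A → A ∈ 𝔐

  record IsMeasure (X : Pred Ω ℓ) (𝔐 : Family) (μ : Graph) : Set (suc ℓ) where
    field
      isPartialFunction : IsPartialFunction X μ
      𝔐⊆dom : ∀ {A} → A ∈ 𝔐 → ∃[ v ] μ A v
      M1 : μ ∅ 0#
      M2 : ∃[ v ] μ X v × 0# ≤ v × ¬ 0# ≈ v
      M3 : ∀ {A B a b} → A ∈ 𝔐 → B ∈ 𝔐 → A ⊆ B → μ A a → μ B b → a ≤ b
      M4 : ∀ (γ : Ordinal ℓ) → γ ∈ Λ ⁺ →
           ∀ (A : Carrier γ → Pred Ω ℓ) → (∀ i → A i ∈ 𝔐) →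
           (∀ i j → i ≢ j → A i ⊥ A j) →
           ∀ (s : Carrier γ → S) → (∀ i → μ (A i) (s i)) →
           ∃[ v ] IsSum γ s v × μ (⋃ (Carrier γ) A) v
      M5 : ∀ {x} → x ∈ X → ｛ x ｝ ∈ 𝔐 →
           ∀ (γ : Ordinal ℓ) → γ ∈ Λ ⁺ →
           ∀ (A : Carrier γ → Pred Ω ℓ) → IsLocalBasis T X x A →
           ∃[ m ] μ ｛ x ｝ m × IsInf (λ a → ∃[ i ] μ (A i) a) m

  record IsWeakMeasureSpace (X : Pred Ω ℓ) (𝔐 : Family) (μ : Graph) : Set (suc ℓ) where
    field
      isWeaklyMeasurable : IsWeaklyMeasurable X 𝔐
      isMeasure          : IsMeasure X 𝔐 μ

  IsContinuous : Pred Ω ℓ → Family → Graph → Set (suc ℓ)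
  IsContinuous X 𝔐 μ = ∀ {x} → x ∈ X → ｛ x ｝ ∈ 𝔐 × μ ｛ x ｝ 0#

  supp : Pred Ω ℓ → Graph → Pred Ω (suc ℓ)
  supp X μ = X ∖ (λ x → Σ[ O ∈ Pred Ω ℓ ] OpenIn T X O × μ O 0# × x ∈ O)

  -- Here Γ is the class of ordinals below the cardinal in question.
  IsDirac : ∀ {g} → Pred (Ordinal ℓ) g → Pred Ω ℓ → Graph → Set (suc (suc ℓ) ⊔ g)
  IsDirac Γ X μ = WeightBelow T (supp X μ) Γ

  infix 8 _↓_
  _↓_ : Family → Pred Ω ℓ → Family
  (𝔐 ↓ Y) A = ∃[ M ] M ∈ 𝔐 × (M ∩ Y) ≐ A

  -- The graph of μ ↓ Y, which depends on 𝔐 as well.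
  restrict : Family → Graph → Pred Ω ℓ → Graph
  restrict 𝔐 μ Y A v =
    A ∈ 𝔐 ↓ Y × IsInf (λ a → ∃[ M ] M ∈ 𝔐 × (M ∩ Y) ≐ A × μ M a) v

  ClosedUnder∩ : Family → Set (suc ℓ)
  ClosedUnder∩ 𝔐 = ∀ {A B} → A ∈ 𝔐 → B ∈ 𝔐 → A ∩ B ∈ 𝔐

  -- μ is the sum of the restrictions μ ↓ P for P in 𝒫: 𝒫 has an enumeration of
  -- length below λ⁺, and the sum along any such enumeration has value μ(M).
  IsSumOfRestrictions : Family → Graph → Pred (Pred Ω ℓ) (suc ℓ) → Set (suc ℓ)
  IsSumOfRestrictions 𝔐 μ 𝒫 =
    (Σ[ γ ∈ Ordinal ℓ ] γ ∈ Λ ⁺ × (∃[ e ] IsEnumeration 𝒫 γ e)) ×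
    (∀ {M} → M ∈ 𝔐 →
     ∀ (γ : Ordinal ℓ) → γ ∈ Λ ⁺ → ∀ e → IsEnumeration 𝒫 γ e →
     ∃[ s ] (∀ i → restrict 𝔐 μ (e i) (M ∩ e i) (s i)) ×
     (∃[ v ] μ M v × IsSum γ s v))

{-# OPTIONS --safe #-}

-- By M5 and continuity, for every c > 0 each point has a ball of measure below
-- c; the largest such balls (the c-cells) partition X into at most λ clopen
-- sets.  Adding up the cells of a set shows two things: every v < μ(X) is
-- exceeded by some multiple of c, and every set of positive measure contains
-- two disjoint ones, so a positive measure can be halved.  If μ(P) < μ(X), then
-- iterated halving of P yields a sequence r of measures coinitial in S ∖ {0},
-- while for each n and m only finitely many r n-cells meet P in measure ≥ r m.
-- These countably many cells form a base of the support of P.  The partition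
-- consists of the μ(X)-cells, with the null ones merged into a positive one.

module Submission where

open import Defs
open import Level using (Level; suc; Lift; lift; lower; _⊔_)
open import Algebra.Bundles using (Monoid)
import Algebra.Properties.Monoid.Mult as Mult
open import Axiom.ExcludedMiddle using (ExcludedMiddle)
open import Axiom.Extensionality.Propositional using (Extensionality)
open import Data.Empty using (⊥-elim)
open import Data.Empty.Polymorphic using () renaming (⊥ to Void)
open import Data.Irrelevant using ([_])
open import Data.List.Base using (List; []; _∷_; length)
open import Data.List.Membership.Propositional using () renaming (_∈_ to _∈ₗ_)
open import Data.List.NonEmpty as List⁺ using (foldr₁; _∷_)
open import Data.List.Relation.Unary.All as All using (All; []; _∷_)
open import Data.List.Relation.Unary.AllPairs using (AllPairs; []; _∷_)
open import Data.List.Relation.Unary.Any using (here; there)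
open import Data.List.Relation.Unary.Linked.Properties using (AllPairs⇒Linked; Linked⇒AllPairs)
open import Data.Nat.Base as ℕ using (ℕ; zero; s≤s; z≤n)
import Data.Nat.Properties as ℕ
open import Data.Product using (Σ-syntax; ∃-syntax; _×_; _,_; proj₁; proj₂; map₂)
open import Data.Refinement.Base using (Refinement; _,_; value)
open import Data.Sum.Base using (inj₁; inj₂)
open import Function.Base using (id; _∘_)
open import Function.Bundles using (_↣_; Injection; mk↣)
open import Function.Construct.Composition using (_↣-∘_)
open import Induction.WellFounded using (Acc; acc)
import Relation.Binary.Construct.On as On
open import Relation.Binary.Definitions using (tri<; tri≈; tri>)
open import Relation.Binary.PropositionalEquality as ≡ using (_≡_; _≢_; refl; sym; trans; cong; subst)
open import Relation.Binary.Structures using (IsStrictTotalOrder; IsTotalOrder)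
open import Relation.Nullary using (¬_; yes; no; decidable-stable; recompute)
open import Relation.Unary using (Pred; _∈_; _⊆_; _≐_; _∩_; _∖_; ⋃; _⊥_; Satisfiable)
open import Relation.Unary.Polymorphic using (∅; U)
open import Relation.Unary.Properties using (≐-refl; ≐-sym; ≐-trans)

private
  variable
    ℓ p q : Level

-- Well-orders: transport along injections, and least elements.

pullback : ∀ {I : Set ℓ} (α : Ordinal ℓ) → I ↣ Ordinal.Carrier α → Ordinal ℓ
pullback {I = I} α f = record
  { Carrier            = I
  ; _<_                = λ i j → to i < to j
  ; isStrictTotalOrder = record
    { isStrictPartialOrder = record
      { isEquivalence = ≡.isEquivalence
      ; irrefl        = λ { refl → α.irrefl refl }
      ; trans         = α.trans
      ; <-resp-≈      = (λ { refl → id }) , (λ { refl → id })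
      }
    ; compare = compare
    }
  ; wellFounded        = On.wellFounded to wellFounded
  }
  where
  open Ordinal α
  module α = IsStrictTotalOrder isStrictTotalOrder
  open Injection f using (to; injective)
  compare : ∀ i j → _
  compare i j with α.compare (to i) (to j)
  ... | tri< a b c = tri< a (b ∘ cong to) c
  ... | tri≈ a b c = tri≈ a (injective b) c
  ... | tri> a b c = tri> a (b ∘ cong to) c

module _ (α : Ordinal ℓ) where
  open Ordinal α
  open IsStrictTotalOrder isStrictTotalOrder using (compare)

  IsLeast : Pred Carrier p → Pred Carrier (ℓ ⊔ p)
  IsLeast P i = P i × (∀ {j} → P j → ¬ j < i)

  least-unique : ∀ {P : Pred Carrier p} {i j} → IsLeast P i → IsLeast P j → i ≡ j
  least-unique {i = i} {j} (Pi , i≤) (Pj , j≤) with compare i j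
  ... | tri< i<j _ _ = ⊥-elim (j≤ Pi i<j)
  ... | tri≈ _ i≡j _ = i≡j
  ... | tri> _ _ j<i = ⊥-elim (i≤ Pj j<i)

  least-resp : ∀ {P : Pred Carrier p} {Q : Pred Carrier q} {i} →
               P ≐ Q → IsLeast P i → IsLeast Q i
  least-resp (P⊆Q , Q⊆P) (Pi , i≤) = P⊆Q Pi , λ Qj → i≤ (Q⊆P Qj)

-- Balls in the bounded topology.

module _ {ℓ} (κ Λ : Ordinal ℓ) where
  open Ordinal κ using (_<_; isStrictTotalOrder)
  open IsStrictTotalOrder isStrictTotalOrder using (compare) renaming (trans to <-trans)
  open Ordinal using (Carrier)

  ball : Seq κ Λ → Carrier κ → Pred (Seq κ Λ) ℓ
  ball x α = cone κ Λ (α , λ β _ → x β)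

  ball-centre : ∀ x α → x ∈ ball x α
  ball-centre x α β β<α = refl

  ball-sym : ∀ {x y α} → y ∈ ball x α → x ∈ ball y α
  ball-sym y∈ β β<α = sym (y∈ β β<α)

  ball-trans : ∀ {x y α} → y ∈ ball x α → ball y α ⊆ ball x α
  ball-trans y∈ z∈ β β<α = trans (z∈ β β<α) (y∈ β β<α)

  ball-antitone : ∀ {x α β} → β < α → ball x α ⊆ ball x β
  ball-antitone β<α y∈ ξ ξ<β = y∈ ξ (<-trans ξ<β β<α)

  -- By induction on the generation of `V`: a cone containing `x` is itself a ball around `x`, and
  -- an intersection takes the larger of two radii. The given element of `κ` is the radius for the
  -- whole space, where any ball will do.
  ball-refines : Carrier κ → ∀ {V x} → Topology.Open (boundedTopology κ Λ) V →
                 x ∈ V → ∃[ α ] ball x α ⊆ V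
  ball-refines α₀ (gen-basic (α , s)) x∈V =
    α , λ y∈ β β<α → trans (y∈ β β<α) (x∈V β β<α)
  ball-refines α₀ gen-whole x∈V = α₀ , λ _ → _
  ball-refines α₀ {x = x} (gen-inter V-open W-open) (x∈V , x∈W)
    with ball-refines α₀ V-open x∈V | ball-refines α₀ W-open x∈W
  ... | α , ⊆V | β , ⊆W with compare α β
  ...   | tri< α<β _ _  = β , λ y∈ → ⊆V (ball-antitone {x} α<β y∈) , ⊆W y∈
  ...   | tri≈ _ refl _ = α , λ y∈ → ⊆V y∈ , ⊆W y∈
  ...   | tri> _ _ β<α  = α , λ y∈ → ⊆V y∈ , ⊆W (ball-antitone {x} β<α y∈)
  ball-refines α₀ (gen-union V V-open) (j , x∈V) =
    map₂ (λ ⊆V y∈ → j , ⊆V y∈) (ball-refines α₀ (V-open j) x∈V)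
  ball-refines α₀ (gen-resp-≐ (V⊆W , W⊆V) V-open) x∈W =
    map₂ (λ ⊆V y∈ → V⊆W (⊆V y∈)) (ball-refines α₀ V-open (W⊆V x∈W))

-- Enumerating pairs and finite lists by natural numbers.

module Unpair where
  next : ℕ × ℕ → ℕ × ℕ
  next (zero    , b) = ℕ.suc b , zero
  next (ℕ.suc a , b) = a , ℕ.suc b

  -- Walks along the antidiagonals of ℕ × ℕ.
  unpair : ℕ → ℕ × ℕ
  unpair zero      = zero , zero
  unpair (ℕ.suc n) = next (unpair n)

  -- The walk enters an antidiagonal at `(b + a , 0)` and reaches `(a , b)` exactly `b` steps later.
  along : ∀ b a → (∃[ n ] unpair n ≡ (b ℕ.+ a , zero)) → ∃[ n ] unpair n ≡ (a , b)
  along zero a h = h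
  along (ℕ.suc b) a (n , eq)
    with m , eq′ ← along b (ℕ.suc a) (n , trans eq (cong (_, zero) (sym (ℕ.+-suc b a)))) =
    ℕ.suc m , cong next eq′

  diagonal : ∀ s → ∃[ n ] unpair n ≡ (s , zero)
  diagonal zero = zero , refl
  diagonal (ℕ.suc s)
    with n , eq ← along s zero (subst (λ t → ∃[ n ] unpair n ≡ (t , zero)) (sym (ℕ.+-identityʳ s)) (diagonal s)) =
    ℕ.suc n , cong next eq

  unpair-surjective : ∀ ab → ∃[ n ] unpair n ≡ ab
  unpair-surjective (a , b) = along b a (diagonal (b ℕ.+ a))

open Unpair using (unpair; unpair-surjective)

-- The default `d` fills all positions past the end, so that countably many finite lists can be read
-- as one sequence.
nth : ∀ {A : Set ℓ} → A → List A → ℕ → A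
nth d []       _         = d
nth d (x ∷ xs) zero      = x
nth d (x ∷ xs) (ℕ.suc k) = nth d xs k

nth-surjective : ∀ {A : Set ℓ} (d : A) {x xs} → x ∈ₗ xs → ∃[ k ] nth d xs k ≡ x
nth-surjective d (here refl) = zero , refl
nth-surjective d (there x∈)  with k , eq ← nth-surjective d x∈ = ℕ.suc k , eq

-- Finite and infinitary sums in the monoid.

module Sums {ℓ} (𝕊 : PositiveTotallyOrderedMonoid ℓ) where
  open PositiveTotallyOrderedMonoid 𝕊
  open IsTotalOrder isTotalOrder public
    using (antisym; total; module Eq)
    renaming (refl to ≤-refl; trans to ≤-trans; reflexive to ≤-reflexive)
  open Ordinal using (Carrier)

  monoid : Monoid ℓ ℓ
  monoid = record { isMonoid = isMonoid }
  open Monoid monoid public using (identityˡ; identityʳ)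
  open Mult monoid public using () renaming (_×_ to _·_; ×-assocˡ to ·-assocˡ)

  ≰⇒≥ : ∀ {a b} → ¬ a ≤ b → b ≤ a
  ≰⇒≥ {a} {b} a≰b with total a b
  ... | inj₁ a≤b = ⊥-elim (a≰b a≤b)
  ... | inj₂ b≤a = b≤a

  a≤a+b : ∀ {a b} → a ≤ a + b
  a≤a+b {a} {b} = ≤-trans (≤-reflexive (Eq.sym (identityʳ a))) (+-mono-≤ ≤-refl (0-minimum b))

  ·-monoʳ : ∀ n {a b} → a ≤ b → n · a ≤ n · b
  ·-monoʳ zero      a≤b = ≤-refl
  ·-monoʳ (ℕ.suc n) a≤b = +-mono-≤ a≤b (·-monoʳ n a≤b)

  ·-monoˡ : ∀ {m n} a → m ℕ.≤ n → m · a ≤ n · a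
  ·-monoˡ a z≤n       = 0-minimum _
  ·-monoˡ a (s≤s m≤n) = +-mono-≤ ≤-refl (·-monoˡ a m≤n)

  module _ {I : Set ℓ} (s : I → S) where

    sum : I → List I → S
    sum α αs = foldr₁ _+_ (List⁺.map s (α ∷ αs))

    sum-≤ : ∀ {c} → (∀ i → s i ≤ c) → ∀ α αs → sum α αs ≤ ℕ.suc (length αs) · c
    sum-≤ s≤c α []       = ≤-trans (s≤c α) a≤a+b
    sum-≤ s≤c α (β ∷ αs) = +-mono-≤ (s≤c α) (sum-≤ s≤c β αs)

    sum-≥ : ∀ {c α αs} → All (λ i → c ≤ s i) (α ∷ αs) → ℕ.suc (length αs) · c ≤ sum α αs
    sum-≥ (c≤ ∷ [])         = ≤-trans (≤-reflexive (identityʳ _)) c≤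
    sum-≥ (c≤ ∷ cs@(_ ∷ _)) = +-mono-≤ c≤ (sum-≥ cs)

    sum-null : ∀ {α αs} → All (λ i → s i ≤ 0#) (α ∷ αs) → sum α αs ≤ 0#
    sum-null (z ∷ [])         = z
    sum-null (z ∷ zs@(_ ∷ _)) =
      ≤-trans (+-mono-≤ z (sum-null zs)) (≤-reflexive (identityˡ 0#))

  module _ (γ : Ordinal ℓ) (s : Carrier γ → S) where
    open Ordinal γ using (_<_)
    open IsStrictTotalOrder (Ordinal.isStrictTotalOrder γ)
      using (_≟_; irrefl) renaming (trans to <-trans)

    -- A strictly increasing list meets `i` at most once: if `i` is the head, every later index
    -- differs from it and contributes nothing; otherwise the head itself is null.
    sum-single : ∀ i → (∀ j → j ≢ i → s j ≤ 0#) →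
                 ∀ {α αs} → AllPairs _<_ (α ∷ αs) → sum s α αs ≤ s i
    sum-single i null {α} {[]} _ with α ≟ i
    ... | yes refl = ≤-refl
    ... | no α≢i   = ≤-trans (null α α≢i) (0-minimum _)
    sum-single i null {α} {β ∷ αs} (α< ∷ pairs) with α ≟ i
    ... | yes refl =
      ≤-trans (+-mono-≤ ≤-refl
                (sum-null s (All.map (λ α<j → null _ (λ j≡α → irrefl (sym j≡α) α<j)) α<)))
              (≤-reflexive (identityʳ _))
    ... | no α≢i   =
      ≤-trans (+-mono-≤ (null α α≢i) (sum-single i null pairs)) (≤-reflexive (identityˡ _))

    module _ {v} (isSum : IsSum γ s v) where

      isSum-≥ : ∀ {α αs} → AllPairs _<_ (α ∷ αs) → sum s α αs ≤ v
      isSum-≥ pairs = proj₁ isSum (_ , _ , AllPairs⇒Linked pairs , Eq.refl)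

      isSum-≤ : ∀ {u} → (∀ {α αs} → AllPairs _<_ (α ∷ αs) → sum s α αs ≤ u) → v ≤ u
      isSum-≤ bound = proj₂ isSum _
        (λ (α , αs , linked , a≈) → ≤-trans (≤-reflexive a≈) (bound (Linked⇒AllPairs <-trans linked)))

      isSum-resp : ∀ {u} → v ≈ u → IsSum γ s u
      isSum-resp v≈u =
        (λ a∈ → ≤-trans (proj₁ isSum a∈) (≤-reflexive v≈u)) ,
        (λ w bound → ≤-trans (≤-reflexive (Eq.sym v≈u)) (proj₂ isSum w bound))

      -- A list of `N` or more terms, each at least `c`, would have a finite sum of at least
      -- `N · c`, yet all finite sums stay below `v`.
      large-length : ∀ {c} N → ¬ N · c ≤ v →
                     ∀ {αs} → AllPairs _<_ αs → All (λ i → c ≤ s i) αs → length αs ℕ.≤ N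
      large-length N N·c≰v {[]}     _     _   = z≤n
      large-length {c} N N·c≰v {α ∷ αs} pairs cs = ℕ.≰⇒≥ λ N≤ →
        N·c≰v (≤-trans (·-monoˡ c N≤) (≤-trans (sum-≥ s cs) (isSum-≥ pairs)))

-- Classical least elements and finiteness.

module Classical (em : ∀ {a} → ExcludedMiddle a) where

  dne : ∀ {A : Set p} → ¬ ¬ A → A
  dne = decidable-stable em

  module _ (α : Ordinal ℓ) where
    open Ordinal α
    open IsStrictTotalOrder isStrictTotalOrder using (compare)

    least : ∀ {P : Pred Carrier p} → ∃[ i ] P i → ∃[ i ] IsLeast α P i
    least {P = P} (i , Pi) = go i Pi (wellFounded i)
      where
      go : ∀ i → P i → Acc _<_ i → ∃[ j ] IsLeast α P j
      go i Pi (acc rs) with em {P = ∃[ j ] P j × j < i}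
      ... | yes (j , Pj , j<i) = go j Pj (rs j<i)
      ... | no none            = i , Pi , λ Pj j<i → none (_ , Pj , j<i)

    -- Remove the least element `d` of `D`. Any increasing list in the rest can be extended by `d`
    -- at the front, so the bound on lengths drops by one.
    finite : ∀ n (D : Pred Carrier p) →
             (∀ {αs} → AllPairs _<_ αs → All D αs → length αs ℕ.≤ n) →
             ∃[ αs ] (∀ {i} → D i → i ∈ₗ αs)
    finite n D bound with em {P = Satisfiable D}
    ... | no empty = [] , λ Di → ⊥-elim (empty (_ , Di))
    ... | yes inhabited with least inhabited
    finite zero D bound | yes _ | d , Dd , _
      with () ← bound ([] ∷ []) (Dd ∷ [])
    finite (ℕ.suc n) D bound | yes _ | d , Dd , d≤
      with αs , complete ← finite n (λ i → D i × d < i) (λ pairs Ds →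
             ℕ.s≤s⁻¹ (bound (All.map proj₂ Ds ∷ pairs) (Dd ∷ All.map proj₁ Ds))) =
      d ∷ αs , λ {i} Di → case i Di (compare i d)
      where
      case : ∀ i → D i → _ → i ∈ₗ (d ∷ αs)
      case i Di (tri< i<d _ _) = ⊥-elim (d≤ Di i<d)
      case i Di (tri≈ _ i≡d _) = here i≡d
      case i Di (tri> _ _ d<i) = there (complete (Di , d<i))

-- Values of the measure, small balls and cells.

module Decompose
  (em : ∀ {a} → ExcludedMiddle a) {ℓ} (κ Λ : Ordinal ℓ)
  (α₀ : Ordinal.Carrier κ)
  (κ↣Λ : Ordinal.Carrier κ ↣ Ordinal.Carrier Λ)
  (ℕ↣Λ : ℕ ↣ Ordinal.Carrier Λ)
  (X : Pred (Seq κ Λ) ℓ)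
  (δ : Ordinal ℓ) (δ↣Λ : Ordinal.Carrier δ ↣ Ordinal.Carrier Λ)
  (B : Ordinal.Carrier δ → Pred (Seq κ Λ) ℓ) (isBase : IsBase (boundedTopology κ Λ) X B)
  (𝕊 : PositiveTotallyOrderedMonoid ℓ)
  (𝔐 : Measure.Family (boundedTopology κ Λ) Λ 𝕊)
  (μ : Measure.Graph (boundedTopology κ Λ) Λ 𝕊)
  (space : Measure.IsWeakMeasureSpace (boundedTopology κ Λ) Λ 𝕊 X 𝔐 μ)
  (continuous : Measure.IsContinuous (boundedTopology κ Λ) Λ 𝕊 X 𝔐 μ)
  (∩-closed : Measure.ClosedUnder∩ (boundedTopology κ Λ) Λ 𝕊 𝔐)
  where

  private
    T = boundedTopology κ Λ
    Ω = Seq κ Λ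
    I = Ordinal.Carrier δ
  open Ordinal using (Carrier)
  open Topology T using (Open)
  open Measure T Λ 𝕊
  open PositiveTotallyOrderedMonoid 𝕊
  open Sums 𝕊
  open Classical em
  open IsWeakMeasureSpace space
  open IsWeaklyMeasurable isWeaklyMeasurable
  open IsMeasure isMeasure
  open IsPartialFunction isPartialFunction

  -- The value depends on the membership proof; by `functional`, two proofs give values related by
  -- `_≈_`.
  meas : ∀ {A} → A ∈ 𝔐 → S
  meas A∈ = proj₁ (𝔐⊆dom A∈)

  μ-meas : ∀ {A} (A∈ : A ∈ 𝔐) → μ A (meas A∈)
  μ-meas A∈ = proj₂ (𝔐⊆dom A∈)

  meas-mono : ∀ {A C} (A∈ : A ∈ 𝔐) (C∈ : C ∈ 𝔐) → A ⊆ C → meas A∈ ≤ meas C∈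
  meas-mono A∈ C∈ A⊆C = M3 A∈ C∈ A⊆C (μ-meas A∈) (μ-meas C∈)

  meas-empty : ∀ {A} (A∈ : A ∈ 𝔐) → ¬ Satisfiable A → meas A∈ ≤ 0#
  meas-empty A∈ empty = ≤-reflexive
    (functional (μ-meas A∈) (resp ((λ ()) , λ a → ⊥-elim (empty (_ , a))) Eq.refl M1))

  satisfiable : ∀ {A} (A∈ : A ∈ 𝔐) → ¬ meas A∈ ≤ 0# → Satisfiable A
  satisfiable A∈ pos = dne λ empty → pos (meas-empty A∈ empty)

  X-open : OpenIn T X X
  X-open = U , Topology.whole T , (λ x∈ → _ , x∈) , proj₂

  X∈ : X ∈ 𝔐
  X∈ = opens X-open

  X-positive : ¬ meas X∈ ≤ 0#
  X-positive X≤0 with v , μXv , 0≤v , 0≉v ← M2 =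
    0≉v (antisym 0≤v (≤-trans (≤-reflexive (functional μXv (μ-meas X∈))) X≤0))

  ∅∈ : ∅ ∈ 𝔐
  ∅∈ = opens (⋃ Void (λ _ → U) , Topology.union T _ (λ ()) , (λ ()) , λ ())

  measure-sum : ∀ (γ : Ordinal ℓ) → γ ∈ Λ ⁺ →
                (A : Carrier γ → Pred Ω ℓ) (A∈ : ∀ i → A i ∈ 𝔐) →
                (∀ i j → i ≢ j → A i ⊥ A j) →
                ∀ {C} (C∈ : C ∈ 𝔐) → ⋃ (Carrier γ) A ≐ C →
                ∀ s → (∀ i → μ (A i) (s i)) → IsSum γ s (meas C∈)
  measure-sum γ γ↣Λ A A∈ disjoint C∈ ⋃≐C s μs
    with v , isSum , μ⋃ ← M4 γ γ↣Λ A A∈ disjoint s μs =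
    isSum-resp γ s isSum (functional (resp ⋃≐C Eq.refl μ⋃) (μ-meas C∈))

  ball-open : ∀ x α → OpenIn T X (ball κ Λ x α ∩ X)
  ball-open x α = ball κ Λ x α , gen-basic _ , ≐-refl

  ball∈ : ∀ x α → (ball κ Λ x α ∩ X) ∈ 𝔐
  ball∈ x α = opens (ball-open x α)

  size : Ω → Carrier κ → S
  size x α = meas (ball∈ x α)

  -- The balls around `x` form a local basis of length `κ`, which `κ↣Λ` makes admissible for M5. By
  -- M5 their measures have infimum 0, so `c > 0` cannot be a lower bound.
  small-ball : ∀ {c x} → ¬ c ≤ 0# → x ∈ X → ∃[ α ] ¬ c ≤ size x α
  small-ball {c} {x} c≰0 x∈X = dne λ none →
    let singleton∈ , μx0 = continuous x∈X
        m , μxm , _ , greatest = M5 x∈X singleton∈ κ κ↣Λ (λ α → ball κ Λ x α ∩ X) localBasis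
    in c≰0 (≤-trans
         (greatest c λ (α , μa) → ≤-trans (dne λ c≰ → none (α , c≰))
                                          (≤-reflexive (functional (μ-meas (ball∈ x α)) μa)))
         (≤-reflexive (functional μxm μx0)))
    where
    localBasis : IsLocalBasis T X x (λ α → ball κ Λ x α ∩ X)
    localBasis = record
      { open-B  = ball-open x
      ; x∈B     = λ α → ball-centre κ Λ x α , x∈X
      ; refines = λ A (V , V-open , A⊆ , ⊆A) x∈A →
          map₂ (λ ball⊆V (y∈ , y∈X) → ⊆A (ball⊆V y∈ , y∈X))
               (ball-refines κ Λ α₀ V-open (proj₁ (A⊆ x∈A)))
      }

  -- The c-cells are the largest balls of measure below c.  A cell is labelled
  -- by the least basic open set inside it; unused labels have an empty cell.
  module Cells (c : S) (c≰0 : ¬ c ≤ 0#) where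

    abstract
      Radius : Ω → Pred (Carrier κ) ℓ
      Radius x = IsLeast κ (λ α → ¬ c ≤ size x α)

      -- The ultrametric property: if `y` lies in the ball of radius `α` around `x`, the balls
      -- around `x` and `y` agree for every radius up to `α`, and so do their sizes.
      radius-resp : ∀ {x y α} → y ∈ ball κ Λ x α → Radius x α → Radius y α
      radius-resp {x} {y} {α} y∈ (small , minimal) =
        (λ c≤ → small (≤-trans c≤ (shrink y∈))) ,
        λ {β} small-y β<α → minimal
          (λ c≤ → small-y (≤-trans c≤ (shrink (ball-sym κ Λ {x} (ball-antitone κ Λ {x} β<α y∈))))) β<α
        where
        shrink : ∀ {x y α} → y ∈ ball κ Λ x α → size y α ≤ size x α
        shrink {x} {y} {α} y∈ = meas-mono (ball∈ y α) (ball∈ x α)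
          λ (z∈ , z∈X) → ball-trans κ Λ {x} y∈ z∈ , z∈X

      Label : Ω → Carrier κ → Pred I ℓ
      Label x α i = Satisfiable (B i) × B i ⊆ ball κ Λ x α

      cell : I → Pred Ω ℓ
      cell i x = x ∈ X × ∃[ α ] Radius x α × IsLeast δ (Label x α) i

      cell-covers : ∀ {x} → x ∈ X → ∃[ i ] x ∈ cell i
      cell-covers {x} x∈X with α , Rα ← least κ (small-ball c≰0 x∈X) =
        map₂ (λ label → x∈X , α , Rα , label) (least δ inhabited)
        where
        inhabited : ∃[ i ] Label x α i
        inhabited
          with i , x∈B , B⊆ ← IsBase.refines isBase (ball κ Λ x α ∩ X) (ball-open x α)
                                (ball-centre κ Λ x α , x∈X) =
          i , (x , x∈B) , λ y∈ → proj₁ (B⊆ y∈)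

      cell-unique : ∀ {x i j} → x ∈ cell i → x ∈ cell j → i ≡ j
      cell-unique (_ , α , R , label) (_ , α′ , R′ , label′)
        with refl ← least-unique κ R R′ = least-unique δ label label′

      -- The balls of two points of one cell both contain the base set `B i`. It is nonempty by
      -- `Label`, and a common point `z` forces equal radii through `radius-resp`, hence equal
      -- balls.
      cell-ball : ∀ {x i} → x ∈ cell i →
                  ∃[ α ] ¬ c ≤ size x α × cell i ≐ (ball κ Λ x α ∩ X)
      cell-ball {x} {i} (_ , α , R , label@((z , z∈) , B⊆x) , label-least) =
        α , proj₁ R , cell⊆ , ⊆cell
        where
        cell⊆ : cell i ⊆ ball κ Λ x α ∩ X
        cell⊆ {y} (y∈X , α′ , R′ , (_ , B⊆y) , _)
          with refl ← least-unique κ (radius-resp (B⊆x z∈) R) (radius-resp (B⊆y z∈) R′) =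
          ball-trans κ Λ {x} (B⊆x z∈) (ball-sym κ Λ {y} (B⊆y z∈)) , y∈X
        ⊆cell : ball κ Λ x α ∩ X ⊆ cell i
        ⊆cell {y} (y∈ , y∈X) = y∈X , α , radius-resp y∈ R ,
          least-resp δ
            ((λ (sat , B⊆) → sat , λ w∈ → ball-trans κ Λ {y} (ball-sym κ Λ {x} y∈) (B⊆ w∈)) ,
             (λ (sat , B⊆) → sat , λ w∈ → ball-trans κ Λ {x} y∈ (B⊆ w∈)))
            (label , label-least)

      -- Every point of a cell brings its whole ball along. Arbitrary `D` is allowed because the
      -- pieces of the final partition and their complements are both unions of cells.
      cells-open : (D : Pred I ℓ) → OpenIn T X (λ y → ∃[ i ] y ∈ cell i × D i)
      cells-open D =
        ⋃ (Σ[ x ∈ Ω ] Σ[ i ∈ I ] x ∈ cell i × D i)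
          (λ (x , i , x∈ , _) → ball κ Λ x (proj₁ (cell-ball x∈))) ,
        gen-union _ (λ _ → gen-basic _) ,
        (λ {y} (i , y∈ , Di) → ((y , i , y∈ , Di) , ball-centre κ Λ y _) , proj₁ y∈) ,
        λ (((x , i , x∈ , Di) , y∈) , y∈X) → i , proj₂ (proj₂ (proj₂ (cell-ball x∈))) (y∈ , y∈X) , Di

      cell-open : ∀ i → OpenIn T X (cell i)
      cell-open i with V , V-open , ⊆V , V⊆ ← cells-open (_≡ i) =
        V , V-open , (λ y∈ → ⊆V (i , y∈ , refl)) , λ y∈ → strip (V⊆ y∈)
        where
        strip : ∀ {y} → (∃[ j ] y ∈ cell j × j ≡ i) → y ∈ cell i
        strip (_ , y∈ , refl) = y∈

      cell∈ : ∀ i → cell i ∈ 𝔐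
      cell∈ i = opens (cell-open i)

      cell-small : ∀ i → ¬ c ≤ meas (cell∈ i)
      cell-small i c≤ with em {P = Satisfiable (cell i)}
      ... | no empty = c≰0 (≤-trans c≤ (meas-empty (cell∈ i) empty))
      ... | yes (x , x∈) with α , small , cell⊆ , _ ← cell-ball x∈ =
        small (≤-trans c≤ (meas-mono (cell∈ i) (ball∈ x α) cell⊆))

    module _ {C} (C∈ : C ∈ 𝔐) where

      part∈ : ∀ i → (cell i ∩ C) ∈ 𝔐
      part∈ i = ∩-closed (cell∈ i) C∈

      part : I → S
      part i = meas (part∈ i)

      part-small : ∀ i → ¬ c ≤ part i
      part-small i c≤ = cell-small i (≤-trans c≤ (meas-mono (part∈ i) (cell∈ i) proj₁))

      abstract
        part-sum : IsSum δ part (meas C∈)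
        part-sum = measure-sum δ δ↣Λ (λ i → cell i ∩ C) part∈
          (λ i j i≢j ((x∈i , _) , (x∈j , _)) → i≢j (cell-unique x∈i x∈j))
          C∈ ((λ (i , _ , x∈C) → x∈C) , λ x∈C → map₂ (_, x∈C) (cell-covers (𝔐⊆ C∈ x∈C)))
          part (λ i → μ-meas (part∈ i))

        some-positive : ¬ meas C∈ ≤ 0# → ∃[ i ] ¬ part i ≤ 0#
        some-positive C≰0 = dne λ none → C≰0 (isSum-≤ δ part part-sum
          λ {α} {αs} _ → sum-null part {α} {αs} (All.universal (λ i → dne λ pos → none (i , pos)) _))

  -- Multiples and halving.

  abstract
    -- All `c`-cells weigh at most `c`, so a finite sum of `k` of them is at most `k · c`. If every
    -- multiple stayed below `v`, so would the supremum of these sums, which is the measure of `X`.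
    multiple-exceeds : ∀ {v c} → ¬ meas X∈ ≤ v → ¬ c ≤ 0# → ∃[ N ] ¬ N · c ≤ v
    multiple-exceeds {v} {c} X≰v c≰0 = dne λ none → X≰v
      (isSum-≤ δ (part X∈) (part-sum X∈) λ {α} {αs} _ →
        ≤-trans (sum-≤ (part X∈) (λ i → ≰⇒≥ (part-small X∈ i)) α αs)
                (dne λ N≰ → none (ℕ.suc (length αs) , N≰)))
      where open Cells c c≰0

  Positive : Set (suc ℓ)
  Positive = Σ[ C ∈ Pred Ω ℓ ] Σ[ C∈ ∈ C ∈ 𝔐 ] ¬ meas C∈ ≤ 0#

  mass : Positive → S
  mass (_ , C∈ , _) = meas C∈

  -- Each cell at level mass P carries less than all of P, so at least two of
  -- the summands are positive.
  halve : ∀ P → Σ[ Q ∈ Positive ] mass Q + mass Q ≤ mass P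
  halve (C , C∈ , C≰0) with some-positive C∈ C≰0
    where open Cells (meas C∈) C≰0
  ... | i , i-pos = conclude (compare i j)
    where
    open Cells (meas C∈) C≰0
    open Ordinal δ using (_<_; isStrictTotalOrder)
    open IsStrictTotalOrder isStrictTotalOrder using (compare)

    s = part C∈

    second : ∃[ j ] j ≢ i × ¬ s j ≤ 0#
    second = dne λ none → part-small C∈ i
      (isSum-≤ δ s (part-sum C∈) (sum-single δ s i λ j j≢i → dne λ pos → none (j , j≢i , pos)))

    j = proj₁ second

    -- Doubling the smaller part stays below the sum of both. The summands must appear in the order
    -- of their labels, as addition need not commute.
    lighter : ∀ {a b} → a < b → ¬ s a ≤ 0# → ¬ s b ≤ 0# →
              Σ[ Q ∈ Positive ] mass Q + mass Q ≤ meas C∈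
    lighter {a} {b} a<b a-pos b-pos with total (s a) (s b)
    ... | inj₁ a≤b = (_ , part∈ C∈ a , a-pos) ,
      ≤-trans (+-mono-≤ ≤-refl a≤b) (isSum-≥ δ s (part-sum C∈) ((a<b ∷ []) ∷ [] ∷ []))
    ... | inj₂ b≤a = (_ , part∈ C∈ b , b-pos) ,
      ≤-trans (+-mono-≤ b≤a ≤-refl) (isSum-≥ δ s (part-sum C∈) ((a<b ∷ []) ∷ [] ∷ []))

    conclude : _ → Σ[ Q ∈ Positive ] mass Q + mass Q ≤ meas C∈
    conclude (tri< i<j _ _) = lighter i<j i-pos (proj₂ (proj₂ second))
    conclude (tri≈ _ i≡j _) = ⊥-elim (proj₁ (proj₂ second) (sym i≡j))
    conclude (tri> _ _ j<i) = lighter j<i (proj₂ (proj₂ second)) i-pos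

  halves : Positive → ℕ → Positive
  halves P zero      = P
  halves P (ℕ.suc n) = proj₁ (halve (halves P n))

  -- A linear factor is enough to outrun any fixed multiple. The induction uses `n + 2 ≤ 2 (n + 1)`,
  -- so that each halving pays for one more copy.
  halves-bound : ∀ P n → ℕ.suc n · mass (halves P n) ≤ mass P
  halves-bound P zero      = ≤-reflexive (identityʳ _)
  halves-bound P (ℕ.suc n) =
    ≤-trans (·-monoˡ r′ (s≤s (s≤s (ℕ.m≤m*n n 2))))
      (≤-trans (≤-reflexive (Eq.sym (·-assocˡ r′ (ℕ.suc n) 2)))
        (≤-trans (·-monoʳ (ℕ.suc n)
                   (≤-trans (+-mono-≤ ≤-refl (≤-reflexive (identityʳ r′))) (proj₂ (halve (halves P n)))))
                 (halves-bound P n)))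
    where r′ = mass (halves P (ℕ.suc n))

  -- Restriction to an open set of intermediate measure.

  module Piece (P : Pred Ω ℓ) (P-open : OpenIn T X P)
               (X≰P : ¬ meas X∈ ≤ meas (opens P-open)) (P≰0 : ¬ meas (opens P-open) ≤ 0#) where

    P∈ : P ∈ 𝔐
    P∈ = opens P-open

    P⊆X : P ⊆ X
    P⊆X = 𝔐⊆ P∈

    -- As `P` is in `𝔐` and `𝔐` is closed under intersections, every trace on `P` is again in `𝔐`.
    ↓⇒ : ∀ {A} → A ∈ 𝔐 ↓ P → A ∈ 𝔐 × A ⊆ P
    ↓⇒ (M , M∈ , M∩P≐A) = resp-≐ M∩P≐A (∩-closed M∈ P∈) , λ x∈ → proj₂ (proj₂ M∩P≐A x∈)

    ⇒↓ : ∀ {A} → A ∈ 𝔐 → A ⊆ P → A ∈ 𝔐 ↓ P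
    ⇒↓ {A} A∈ A⊆P = A , A∈ , proj₁ , λ x∈ → x∈ , A⊆P x∈

    -- A itself attains the infimum that defines (μ ↓ P)(A).
    ⇒restrict : ∀ {A v} → A ∈ 𝔐 → A ⊆ P → μ A v → restrict 𝔐 μ P A v
    ⇒restrict {A} A∈ A⊆P μAv =
      ⇒↓ A∈ A⊆P ,
      (λ (M , M∈ , M∩P≐A , μMa) → M3 A∈ M∈ (λ x∈ → proj₁ (proj₂ M∩P≐A x∈)) μAv μMa) ,
      λ u lower → lower (A , A∈ , (proj₁ , λ x∈ → x∈ , A⊆P x∈) , μAv)

    -- The infimum is attained at `A`, so `v` agrees with the measure of `A`. The axioms for the
    -- restriction thereby reduce to those for `μ`.
    restrict⇒ : ∀ {A v} → restrict 𝔐 μ P A v → A ∈ 𝔐 × A ⊆ P × μ A v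
    restrict⇒ {A} (A∈↓ , lower , greatest)
      with A∈ , A⊆P ← ↓⇒ A∈↓ =
      A∈ , A⊆P , resp ≐-refl (antisym ≤v v≤) (μ-meas A∈)
      where
      v≤ = lower (A , A∈ , (proj₁ , λ x∈ → x∈ , A⊆P x∈) , μ-meas A∈)
      ≤v = greatest (meas A∈) (proj₁ (proj₂ (⇒restrict A∈ A⊆P (μ-meas A∈))))

    open-in-X : ∀ {A : Pred Ω ℓ} → OpenIn T P A → OpenIn T X A
    open-in-X (V , V-open , A⊆ , ⊆A) =
      let W , W-open , P⊆ , ⊆P = P-open in
      (V ∩ W) , Topology.inter T V-open W-open ,
      (λ x∈ → let x∈V , x∈P = A⊆ x∈ in (x∈V , proj₁ (P⊆ x∈P)) , P⊆X x∈P) ,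
      λ ((x∈V , x∈W) , x∈X) → ⊆A (x∈V , ⊆P (x∈W , x∈X))

    open-in-P : ∀ {A : Pred Ω ℓ} → OpenIn T X A → OpenIn T P (A ∩ P)
    open-in-P (V , V-open , A⊆ , ⊆A) =
      V , V-open , (λ (x∈A , x∈P) → proj₁ (A⊆ x∈A) , x∈P) ,
      λ (x∈V , x∈P) → ⊆A (x∈V , P⊆X x∈P) , x∈P

    restrict-measurable : IsWeaklyMeasurable P (𝔐 ↓ P)
    restrict-measurable = record
      { 𝔐⊆     = λ A∈ → proj₂ (↓⇒ A∈)
      ; resp-≐ = λ A≐C (M , M∈ , M∩P≐A) → M , M∈ , ≐-trans M∩P≐A A≐C
      ; union  = λ J↣Λ A A∈ → ⇒↓ (union J↣Λ A (λ i → proj₁ (↓⇒ (A∈ i))))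
                                  (λ (i , x∈) → proj₂ (↓⇒ (A∈ i)) x∈)
      ; opens  = λ {A} A-open → ⇒↓ (opens (open-in-X A-open))
                                  (λ x∈ → proj₂ (proj₁ (proj₂ (proj₂ A-open)) x∈))
      }

    restrict-measure : IsMeasure P (𝔐 ↓ P) (restrict 𝔐 μ P)
    restrict-measure = record
      { isPartialFunction = record
        { dom⊆       = λ r → proj₁ (proj₂ (restrict⇒ r))
        ; resp       = λ A≐C u≈v r → let A∈ , A⊆P , μA = restrict⇒ r in
                       ⇒restrict (resp-≐ A≐C A∈) (λ x∈ → A⊆P (proj₂ A≐C x∈)) (resp A≐C u≈v μA)
        ; functional = λ r r′ →
                       functional (proj₂ (proj₂ (restrict⇒ r))) (proj₂ (proj₂ (restrict⇒ r′)))
        }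
      ; 𝔐⊆dom = λ A∈↓ → let A∈ , A⊆P = ↓⇒ A∈↓ in meas A∈ , ⇒restrict A∈ A⊆P (μ-meas A∈)
      ; M1 = ⇒restrict ∅∈ (λ ()) M1
      ; M2 = meas P∈ , ⇒restrict P∈ id (μ-meas P∈) , 0-minimum _ ,
             λ 0≈P → P≰0 (≤-reflexive (Eq.sym 0≈P))
      ; M3 = λ A∈ C∈ A⊆C r r′ → M3 (proj₁ (↓⇒ A∈)) (proj₁ (↓⇒ C∈)) A⊆C
               (proj₂ (proj₂ (restrict⇒ r))) (proj₂ (proj₂ (restrict⇒ r′)))
      ; M4 = λ γ γ↣Λ A A∈ disjoint s rs →
          let v , isSum , μ⋃ = M4 γ γ↣Λ A (λ i → proj₁ (↓⇒ (A∈ i))) disjoint s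
                                 (λ i → proj₂ (proj₂ (restrict⇒ (rs i))))
          in v , isSum , ⇒restrict (union γ↣Λ A (λ i → proj₁ (↓⇒ (A∈ i))))
                                   (λ (i , x∈) → proj₂ (↓⇒ (A∈ i)) x∈) μ⋃
      -- Since `P` is open in `X`, a local basis at `x` in `P` is also one in `X`: a neighbourhood
      -- `C` is first cut down to `C ∩ P`.
      ; M5 = λ {x} x∈P x∈↓ γ γ↣Λ A isLocalBasis →
          let open IsLocalBasis isLocalBasis
              basis-X : IsLocalBasis T X x A
              basis-X = record
                { open-B  = λ i → open-in-X (open-B i)
                ; x∈B     = x∈B
                ; refines = λ C C-open x∈C →
                    map₂ (λ A⊆ y∈ → proj₁ (A⊆ y∈)) (refines (C ∩ P) (open-in-P C-open) (x∈C , x∈P))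
                }
              A⊆P : ∀ i → A i ⊆ P
              A⊆P = λ i y∈ → proj₂ (proj₁ (proj₂ (proj₂ (open-B i))) y∈)
              m , μxm , lower , greatest = M5 (P⊆X x∈P) (proj₁ (↓⇒ x∈↓)) γ γ↣Λ A basis-X
          in m , ⇒restrict (proj₁ (↓⇒ x∈↓)) (proj₂ (↓⇒ x∈↓)) μxm ,
             (λ (i , r) → lower (i , proj₂ (proj₂ (restrict⇒ r)))) ,
             λ u bound → greatest u λ (i , μa) →
               bound (i , ⇒restrict (opens (open-in-X (open-B i))) (A⊆P i) μa)
      }

    restrict-space : IsWeakMeasureSpace P (𝔐 ↓ P) (restrict 𝔐 μ P)
    restrict-space = record
      { isWeaklyMeasurable = restrict-measurable
      ; isMeasure          = restrict-measure
      }

    restrict-continuous : IsContinuous P (𝔐 ↓ P) (restrict 𝔐 μ P)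
    restrict-continuous x∈P with singleton∈ , μx0 ← continuous (P⊆X x∈P) =
      ⇒↓ singleton∈ (λ { refl → x∈P }) , ⇒restrict singleton∈ (λ { refl → x∈P }) μx0

    -- A countable base of the support.

    abstract
      r : ℕ → S
      r n = mass (halves (P , P∈ , P≰0) n)

      r-positive : ∀ n → ¬ r n ≤ 0#
      r-positive n = proj₂ (proj₂ (halves (P , P∈ , P≰0) n))

      -- Some `N · c` exceeds the measure of `P`, because that is below the measure of `X`; but
      -- `N · r N` does not exceed it, by `halves-bound`.
      r-coinitial : ∀ {c} → ¬ c ≤ 0# → ∃[ n ] ¬ c ≤ r n
      r-coinitial c≰0 with N , N·c≰P ← multiple-exceeds X≰P c≰0 =
        N , λ c≤ → N·c≰P (≤-trans (·-monoʳ N c≤)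
                            (≤-trans (·-monoˡ (r N) (ℕ.n≤1+n N)) (halves-bound (P , P∈ , P≰0) N)))

    module C n = Cells (r n) (r-positive n)

    -- The parts of `P` in the `r n`-cells add up to the measure of `P`, which some `N · r m`
    -- exceeds; so at most `N` of them can reach `r m`.
    large : ∀ n m → ∃[ is ] (∀ {i} → r m ≤ C.part n P∈ i → i ∈ₗ is)
    large n m with N , N·r≰P ← multiple-exceeds X≰P (r-positive m) =
      finite δ N _ (large-length δ (C.part n P∈) (C.part-sum n P∈) N N·r≰P)

    support : Pred Ω (suc ℓ)
    support = supp P (restrict 𝔐 μ P)

    support-positive : ∀ {x} → x ∈ support → ∀ {A} (A-open : OpenIn T X A) (A∈ : (A ∩ P) ∈ 𝔐) →
                       x ∈ A → ¬ meas A∈ ≤ 0#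
    support-positive (x∈P , ¬null) {A} A-open A∈ x∈A A≤0 =
      ¬null (A ∩ P , open-in-P A-open ,
        ⇒restrict A∈ proj₂ (resp ≐-refl (antisym A≤0 (0-minimum _)) (μ-meas A∈)) , x∈A , x∈P)

    i₀ : I
    i₀ = proj₁ (C.some-positive 0 P∈ P≰0)

    -- A code consists of the cell level, the threshold and a position in the list from `large`.
    -- Past the end of the list it names the cell of `i₀`, which is open and so harmless in a base.
    base-cell : ℕ × ℕ × ℕ → Pred Ω ℓ
    base-cell (n , m , l) = C.cell n (nth i₀ (proj₁ (large n m)) l)

    base-cell-open : ∀ code → OpenIn T X (base-cell code)
    base-cell-open (n , m , l) = C.cell-open n _

    decode : ℕ → ℕ × ℕ × ℕ
    decode k = map₂ unpair (unpair k)

    base-cell-complete : ∀ n m {i} → r m ≤ C.part n P∈ i → ∃[ k ] base-cell (decode k) ≡ C.cell n i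
    base-cell-complete n m r≤ =
      let l , nth≡i = nth-surjective i₀ (proj₂ (large n m) r≤)
          k′ , eq′  = unpair-surjective (m , l)
          k , eq    = unpair-surjective (n , k′)
      in k , trans (cong base-cell (trans (cong (map₂ unpair) eq) (cong (n ,_) eq′)))
                   (cong (C.cell n) nth≡i)

    -- The cell is a ball around `x` of measure below `r n`. Were its radius smaller than `β`, it
    -- would contain the ball of radius `β`, whose trace on `P` already has measure at least `r n`.
    cell-in-ball : ∀ n i {x} β → x ∈ C.cell n i →
                   ¬ meas (∩-closed (ball∈ x β) P∈) ≤ r n → C.cell n i ⊆ ball κ Λ x β
    cell-in-ball n i {x} β x∈cell c≰r = conclude (C.cell-ball n x∈cell)
      where
      open Ordinal κ using (isStrictTotalOrder)
      open IsStrictTotalOrder isStrictTotalOrder using (compare)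
      smaller : ∀ {α} → ¬ r n ≤ size x α → ball κ Λ x α ⊆ ball κ Λ x β
      smaller {α} small with compare α β
      ... | tri≈ _ refl _ = id
      ... | tri> _ _ β<α  = ball-antitone κ Λ {x} β<α
      ... | tri< α<β _ _  = ⊥-elim (small (≤-trans (≰⇒≥ c≰r)
        (meas-mono (∩-closed (ball∈ x β) P∈) (ball∈ x α)
          λ ((y∈ , y∈X) , _) → ball-antitone κ Λ {x} α<β y∈ , y∈X)))
      conclude : ∃[ α ] ¬ r n ≤ size x α × C.cell n i ≐ (ball κ Λ x α ∩ X) →
                 C.cell n i ⊆ ball κ Λ x β
      conclude (α , small , cell⊆ , _) y∈ = smaller small (proj₁ (cell⊆ y∈))

    -- A cell around a support point meets `P` in positive measure, hence in measure at least `r m`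
    -- for some `m`, and is listed by `large n m`.
    positive-cell : ∀ n i {x} → x ∈ support → x ∈ C.cell n i →
                    ∃[ k ] base-cell (decode k) ≡ C.cell n i
    positive-cell n i x∈s x∈cell = conclude
      (r-coinitial (support-positive x∈s (C.cell-open n i) (C.part∈ n P∈ i) x∈cell))
      where
      conclude : ∃[ m ] ¬ C.part n P∈ i ≤ r m → ∃[ k ] base-cell (decode k) ≡ C.cell n i
      conclude (m , part≰r) = base-cell-complete n m (≰⇒≥ part≰r)

    -- The ball around a support point meets `P` in positive measure; choose `r n` below that
    -- measure and take the `r n`-cell of `x`.
    small-base-cell : ∀ {x} → x ∈ support → ∀ β →
                      ∃[ k ] x ∈ base-cell (decode k) × base-cell (decode k) ⊆ ball κ Λ x β
    small-base-cell {x} x∈s β = radius-below (r-coinitial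
      (support-positive x∈s (ball-open x β) (∩-closed (ball∈ x β) P∈) (ball-centre κ Λ x β , x∈X)))
      where
      x∈X : x ∈ X
      x∈X = P⊆X (proj₁ x∈s)
      label : ∀ n i → x ∈ C.cell n i → C.cell n i ⊆ ball κ Λ x β →
              ∃[ k ] base-cell (decode k) ≡ C.cell n i →
              ∃[ k ] x ∈ base-cell (decode k) × base-cell (decode k) ⊆ ball κ Λ x β
      label n i x∈cell cell⊆ (k , eq) =
        k , subst (x ∈_) (sym eq) x∈cell , λ {y} y∈ → cell⊆ (subst (y ∈_) eq y∈)
      radius-below : ∃[ n ] ¬ meas (∩-closed (ball∈ x β) P∈) ≤ r n →
                     ∃[ k ] x ∈ base-cell (decode k) × base-cell (decode k) ⊆ ball κ Λ x β
      radius-below (n , c≰r) = choose (C.cell-covers n x∈X)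
        where
        choose : ∃[ i ] x ∈ C.cell n i →
                 ∃[ k ] x ∈ base-cell (decode k) × base-cell (decode k) ⊆ ball κ Λ x β
        choose (i , x∈cell) = label n i x∈cell (cell-in-ball n i β x∈cell c≰r)
                                (positive-cell n i x∈s x∈cell)

    support-countable : IsDirac (ω ⁺) P (restrict 𝔐 μ P)
    support-countable =
      -- The natural numbers lifted to level `ℓ`, well-ordered through their injection into `Λ`.
      -- Only their cardinality matters for membership in `ω ⁺`.
      pullback Λ (mk↣ {to = λ (lift k) → to k} λ eq → cong lift (injective eq)) ,
      mk↣ {to = lower} (λ { refl → refl }) ,
      (λ (lift k) → base-cell (decode k) ∩ support) ,
      record { open-B = λ (lift k) → base-open (base-cell-open (decode k)) ; refines = refines }
      where
      open Injection ℕ↣Λ using (to; injective)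

      base-open : ∀ {A : Pred Ω ℓ} → OpenIn T X A → OpenIn T support (A ∩ support)
      base-open (V , V-open , A⊆ , ⊆A) =
        V , V-open , (λ (x∈A , x∈s) → proj₁ (A⊆ x∈A) , x∈s) ,
        λ (x∈V , x∈s) → ⊆A (x∈V , P⊆X (proj₁ x∈s)) , x∈s

      refines : ∀ (A : Pred Ω (suc ℓ)) → OpenIn T support A → ∀ {x} → x ∈ A →
                ∃[ k ] x ∈ (base-cell (decode (lower k)) ∩ support) ×
                       (base-cell (decode (lower k)) ∩ support) ⊆ A
      refines A (V , V-open , A⊆ , ⊆A) {x} x∈A =
        let x∈V , x∈s       = A⊆ x∈A
            β , ball⊆V      = ball-refines κ Λ α₀ V-open x∈V
            k , x∈b , b⊆    = small-base-cell x∈s β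
        in lift k , (x∈b , x∈s) , λ (y∈ , y∈s) → ⊆A (ball⊆V (b⊆ y∈) , y∈s)

  -- The clopen partition and its sum.

  open Cells (meas X∈) X-positive

  Heavy : Pred I ℓ
  Heavy i = ¬ part X∈ i ≤ 0#

  -- Null cells are merged with one fixed heavy cell, since every piece has to
  -- satisfy M2.
  host : I → I
  host j with em {P = Heavy j}
  ... | yes _ = j
  ... | no _  = proj₁ (some-positive X∈ X-positive)

  host-heavy : ∀ j → Heavy (host j)
  host-heavy j with em {P = Heavy j}
  ... | yes heavy = heavy
  ... | no _      = proj₂ (some-positive X∈ X-positive)

  host-fixes : ∀ {j} → Heavy j → host j ≡ j
  host-fixes {j} heavy with em {P = Heavy j}
  ... | yes _     = refl
  ... | no light  = ⊥-elim (light heavy)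

  -- Empty unless `i` is heavy, since `host` takes only heavy values.
  piece : I → Pred Ω ℓ
  piece i y = ∃[ j ] y ∈ cell j × host j ≡ i

  piece-open : ∀ i → OpenIn T X (piece i)
  piece-open i = cells-open (λ j → host j ≡ i)

  piece∈ : ∀ i → piece i ∈ 𝔐
  piece∈ i = opens (piece-open i)

  piece-unique : ∀ {x i j} → x ∈ piece i → x ∈ piece j → i ≡ j
  piece-unique (a , x∈a , refl) (b , x∈b , refl) = cong host (cell-unique x∈a x∈b)

  piece-co-open : ∀ i → OpenIn T X (X ∖ piece i)
  piece-co-open i with V , V-open , ⊆V , V⊆ ← cells-open (λ j → host j ≢ i) =
    V , V-open ,
    (λ (y∈X , y∉) → let j , y∈j = cell-covers y∈X in ⊆V (j , y∈j , λ eq → y∉ (j , y∈j , eq))) ,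
    λ y∈@(_ , y∈X) → let j , y∈j , ≢i = V⊆ y∈ in
      y∈X , λ (k , y∈k , eq) → ≢i (trans (cong host (cell-unique y∈j y∈k)) eq)

  -- Every cell other than `i` meets the piece in a null set: a heavy one is its own host and so
  -- disjoint from the piece, a light one is null anyway. The sum collapses to the part in cell `i`,
  -- which is below the measure of `X`.
  piece-light : ∀ i → ¬ meas X∈ ≤ meas (piece∈ i)
  piece-light i X≤ = part-small (piece∈ i) i (≤-trans X≤
    (isSum-≤ δ (part (piece∈ i)) (part-sum (piece∈ i)) (sum-single δ (part (piece∈ i)) i null)))
    where
    null : ∀ j → j ≢ i → part (piece∈ i) j ≤ 0#
    null j j≢i with em {P = Heavy j}
    ... | yes heavy = meas-empty (part∈ (piece∈ i) j)
      λ (y , y∈j , k , y∈k , eq) →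
        j≢i (trans (sym (host-fixes heavy)) (trans (cong host (cell-unique y∈j y∈k)) eq))
    ... | no light  = ≤-trans
      (meas-mono (part∈ (piece∈ i) j) (part∈ X∈ j) λ (y∈j , y∈) → y∈j , 𝔐⊆ (piece∈ i) y∈)
      (dne light)

  piece-heavy : ∀ {i} → Heavy i → ¬ meas (piece∈ i) ≤ 0#
  piece-heavy {i} heavy ≤0 = heavy (≤-trans
    (meas-mono (part∈ X∈ i) (piece∈ i) λ (y∈ , _) → i , y∈ , host-fixes heavy) ≤0)

  Pieces : Pred (Pred Ω ℓ) (suc ℓ)
  Pieces P = Lift (suc ℓ) (∃[ i ] Heavy i × P ≐ piece i)

  Pieces-clopen : ∀ {P} → P ∈ Pieces → ClopenIn T X P
  Pieces-clopen (lift (i , _ , P⊆ , ⊆P)) =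
    (let V , V-open , ⊆V , V⊆ = piece-open i
     in V , V-open , (λ y∈ → ⊆V (P⊆ y∈)) , λ y∈ → ⊆P (V⊆ y∈)) ,
    (let V , V-open , ⊆V , V⊆ = piece-co-open i
     in V , V-open , (λ (y∈X , y∉) → ⊆V (y∈X , λ y∈ → y∉ (⊆P y∈))) ,
        λ y∈ → let y∈X , y∉ = V⊆ y∈ in y∈X , λ y∈P → y∉ (P⊆ y∈P))

  isClopenPartition : IsClopenPartition T X Pieces
  isClopenPartition = record
    { resp-≐   = λ P≐Q (lift (i , heavy , P≐)) → lift (i , heavy , ≐-trans (≐-sym P≐Q) P≐)
    ; clopen   = Pieces-clopen
    ; nonempty = λ (lift (i , heavy , _ , ⊆P)) →
                   map₂ ⊆P (satisfiable (piece∈ i) (piece-heavy heavy))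
    ; disjoint = λ { (lift (i , _ , P⊆ , ⊆P)) (lift (j , _ , Q⊆ , ⊆Q)) (x , x∈P , x∈Q) →
                   let i≡j = piece-unique (P⊆ x∈P) (Q⊆ x∈Q) in
                   (λ {y} y∈ → ⊆Q (subst (λ k → y ∈ piece k) i≡j (P⊆ y∈))) ,
                   (λ {y} y∈ → ⊆P (subst (λ k → y ∈ piece k) (sym i≡j) (Q⊆ y∈))) }
    ; covers   = λ x∈X → let j , x∈j = cell-covers x∈X in
                   piece (host j) , lift (host j , host-heavy j , ≐-refl) , j , x∈j , refl
    }

  module OfPiece {P} (P∈𝒫 : P ∈ Pieces) where
    private
      P-open = proj₁ (Pieces-clopen P∈𝒫)
      i = proj₁ (lower P∈𝒫)
      heavy = proj₁ (proj₂ (lower P∈𝒫))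
      P≐piece = proj₂ (proj₂ (lower P∈𝒫))
    open Piece P P-open
      (λ X≤P → piece-light i (≤-trans X≤P (meas-mono (opens P-open) (piece∈ i) (proj₁ P≐piece))))
      (λ P≤0 → piece-heavy heavy
        (≤-trans (meas-mono (piece∈ i) (opens P-open) (proj₂ P≐piece)) P≤0))
      public

  -- In a `Refinement` the proof of heaviness is irrelevant, so an index is determined by its label;
  -- `recompute em` recovers the proof where a piece must be shown nonempty.
  enumeration : Σ[ γ ∈ Ordinal ℓ ] γ ∈ Λ ⁺ × (∃[ e ] IsEnumeration Pieces γ e)
  enumeration = pullback δ heavy↣ , δ↣Λ ↣-∘ heavy↣ , piece ∘ value , record
    { member     = λ (i , [ heavy ]) → lift (i , recompute em heavy , ≐-refl)
    ; injective  = injective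
    ; surjective = λ (lift (i , heavy , P≐)) → (i , [ heavy ]) , ≐-sym P≐
    }
    where
    heavy↣ : Refinement I Heavy ↣ I
    heavy↣ = mk↣ {to = value} (λ { refl → refl })
    injective : ∀ {i j} → piece (value i) ≐ piece (value j) → i ≡ j
    injective {i , [ heavy ]} {j , _} (⊆ , _)
      with x , x∈ ← satisfiable (piece∈ i) (piece-heavy (recompute em heavy))
      with refl ← piece-unique x∈ (⊆ x∈) = refl

  -- M4 for the sets `M ∩ e i`, on which the restrictions agree with `μ`. They are disjoint because
  -- overlapping pieces coincide and `e` is injective.
  sum-of-pieces : IsSumOfRestrictions 𝔐 μ Pieces
  sum-of-pieces = enumeration , λ {M} M∈ γ γ↣Λ e isEnum →
    let open IsEnumeration isEnum
        e∈ : ∀ i → (M ∩ e i) ∈ 𝔐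
        e∈ i = ∩-closed M∈ (opens (proj₁ (Pieces-clopen (member i))))
        s = λ i → meas (e∈ i)
    in s ,
       (λ i → OfPiece.⇒restrict (member i) (e∈ i) proj₂ (μ-meas (e∈ i))) ,
       meas M∈ , μ-meas M∈ ,
       measure-sum γ γ↣Λ (λ i → M ∩ e i) e∈
         (λ i j i≢j ((_ , x∈i) , (_ , x∈j)) → ⊥-elim (i≢j (injective
            (IsClopenPartition.disjoint isClopenPartition (member i) (member j) (_ , x∈i , x∈j)))))
         M∈
         ((λ (i , x∈M , _) → x∈M) ,
          λ x∈M → let P , P∈𝒫 , x∈P = IsClopenPartition.covers isClopenPartition (𝔐⊆ M∈ x∈M)
                      i , e≐P = surjective P∈𝒫
                  in i , x∈M , proj₂ e≐P x∈P)
         s (λ i → μ-meas (e∈ i))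

proposition6p10 : (∀ {a} → ExcludedMiddle a) →
    (∀ {a b} → Extensionality a b) →
    ∀ {ℓ} (κ Λ : Ordinal ℓ) →
    IsInfiniteCardinal κ → IsInfiniteCardinal Λ →
    Ordinal.Carrier κ ↣ Ordinal.Carrier Λ →
    IsRegular κ →
    ∀ (X : Pred (Seq κ Λ) ℓ) → WeightAtMost (boundedTopology κ Λ) X Λ →
    ∀ (𝕊 : PositiveTotallyOrderedMonoid ℓ) →
    let open Measure (boundedTopology κ Λ) Λ 𝕊 in
    ∀ (𝔐 : Family) (μ : Graph) →
    IsWeakMeasureSpace X 𝔐 μ → IsContinuous X 𝔐 μ → ClosedUnder∩ 𝔐 →
    Σ[ 𝒫 ∈ Pred (Pred (Seq κ Λ) ℓ) (suc ℓ) ]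
    IsClopenPartition (boundedTopology κ Λ) X 𝒫 ×
    (∀ {P} → P ∈ 𝒫 →
    IsWeakMeasureSpace P (𝔐 ↓ P) (restrict 𝔐 μ P) ×
    IsContinuous P (𝔐 ↓ P) (restrict 𝔐 μ P) ×
    IsDirac (ω ⁺) P (restrict 𝔐 μ P)) ×
    IsSumOfRestrictions 𝔐 μ 𝒫
proposition6p10 em _ κ Λ (_ , ℕ↣κ) (_ , ℕ↣Λ) κ↣Λ _ X (δ , δ↣Λ , B , isBase) 𝕊 𝔐 μ
                space continuous ∩-closed =
  D.Pieces , D.isClopenPartition ,
  (λ P∈𝒫 → D.OfPiece.restrict-space P∈𝒫 , D.OfPiece.restrict-continuous P∈𝒫 ,
            D.OfPiece.support-countable P∈𝒫) ,
  D.sum-of-pieces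
  where
  module D = Decompose em κ Λ (Injection.to ℕ↣κ 0) κ↣Λ ℕ↣Λ X δ δ↣Λ B isBase 𝕊 𝔐 μ
                       space continuous ∩-closed
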